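{- For any positive integers $\alpha,m,n,r$, we have $$\frac{(2,n)}{n(n+1)(n+2)}\sum_{k=1}^{n}k^r(k+1)^r(2k+1)\,w_{k}^{(\alpha)}(x)^{m}\in\mathbb{Z}[x]$$ and $$\frac{(2,n)}{n(n+1)(n+2)}\sum_{k=1}^{n}(-1)^{k}k^r(k+1)^r(2k+1)\,w_{k}^{(\alpha)}(x)^{m}\in\mathbb{Z}[x].$$
   Context: $(2,n)$ denotes the greatest common divisor of $2$ and $n$. For positive integers $k,\alpha$, $$w_k^{(\alpha)}(x)=\sum_{j=1}^{k}w(k,j)^{\alpha}x^{j-1},\qquad w(k,j)=\frac1j\binom{k-1}{j-1}\binom{k+j}{j-1}=\binom{k-1}{j-1}\binom{k+j}{j}-\binom{k}{j}\binom{k+j}{j-1}\in\mathbb{Z}.$$ -}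

module Defs where

open import Algebra.Bundles.Raw using (RawSemiring)
open import Data.Integer.Base as ℤ using (ℤ; +_)
open import Data.List.Base using (List; []; _∷_; map; applyUpTo)
open import Data.Nat.Base using (ℕ; zero; suc; _+_; _*_; _∸_; _^_; NonZero)
open import Data.Nat.Combinatorics using (_C_)
open import Data.Nat.GCD using (gcd)
open import Data.Nat.Properties using (m*n≢0)
open import Data.Product.Base using (∃-syntax)
open import Data.Rational.Base as ℚ using (ℚ; _/_)
import Algebra.Definitions.RawSemiring as RawSemiringDefinitions

-- A univariate polynomial is a list of coefficients, lowest degree first.
-- Trailing zeros are allowed, so equality of polynomials is _≈ₚ_, not _≡_.
module Polynomial {c ℓ} (R : RawSemiring c ℓ) where

  private module R = RawSemiring R

  Poly : Set c
  Poly = List R.Carrier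

  coeff : Poly → ℕ → R.Carrier
  coeff []      _       = R.0#
  coeff (a ∷ _) zero    = a
  coeff (_ ∷ p) (suc i) = coeff p i

  infix  4 _≈ₚ_
  infixl 6 _+ₚ_
  infixl 7 _*ₚ_
  infixr 7 _·ₚ_
  infixr 8 _^ₚ_

  _≈ₚ_ : Poly → Poly → Set ℓ
  p ≈ₚ q = ∀ i → coeff p i R.≈ coeff q i

  _+ₚ_ : Poly → Poly → Poly
  []      +ₚ q       = q
  (a ∷ p) +ₚ []      = a ∷ p
  (a ∷ p) +ₚ (b ∷ q) = (a R.+ b) ∷ (p +ₚ q)

  _·ₚ_ : R.Carrier → Poly → Poly
  a ·ₚ p = map (a R.*_) p

  _*ₚ_ : Poly → Poly → Poly
  []      *ₚ q = []
  (a ∷ p) *ₚ q = (a ·ₚ q) +ₚ (R.0# ∷ (p *ₚ q))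

  _^ₚ_ : Poly → ℕ → Poly
  p ^ₚ zero  = R.1# ∷ []
  p ^ₚ suc m = p *ₚ (p ^ₚ m)

  -- The sum runs over 1 ≤ k ≤ n.
  Σₚ : ℕ → (ℕ → Poly) → Poly
  Σₚ zero    f = []
  Σₚ (suc n) f = Σₚ n f +ₚ f (suc n)

module ℤ[x] = Polynomial ℤ.+-*-rawSemiring
module ℚ[x] = Polynomial ℚ.+-*-rawSemiring

open ℚ[x] public
open RawSemiringDefinitions ℚ.+-*-rawSemiring using () renaming (_^_ to _^ℚ_)

fromℤ : ℤ → ℚ
fromℤ z = z / 1

infix 4 _∈ℤ[x]

_∈ℤ[x] : ℚ[x].Poly → Set
p ∈ℤ[x] = ∃[ q ] p ≈ₚ ℤ[x]→ℚ[x] q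
  where
  ℤ[x]→ℚ[x] : ℤ[x].Poly → ℚ[x].Poly
  ℤ[x]→ℚ[x] = map fromℤ

w : (k j : ℕ) .{{_ : NonZero j}} → ℚ
w k j = + (((k ∸ 1) C (j ∸ 1)) * ((k + j) C (j ∸ 1))) / j

-- Position i carries the coefficient of xⁱ, so j = i + 1.
wPoly : (α k : ℕ) → ℚ[x].Poly
wPoly α k = applyUpTo (λ i → w k (suc i) ^ℚ α) k

prefactor : (n : ℕ) .{{_ : NonZero n}} → ℚ
prefactor n = + gcd 2 n / (n * suc n * suc (suc n))
  where instance
    _ = m*n≢0 n (suc n)
    _ = m*n≢0 (n * suc n) (suc (suc n))

weight : (r k : ℕ) → ℤ
weight r k = + (k ^ r * (k + 1) ^ r * (2 * k + 1))

{-# OPTIONS --safe #-}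

-- Put X = k(k + 1). Then w(k, j) = ∏_{0 < i < j} (X - i(i + 1)) / (j! (j - 1)!), which gives the recurrence
-- X w(k, j) = j(j + 1) (w(k, j) + w(k, j + 1)). From it, by induction on i,
--   w(k, i) w(k, j) = Σ_l C(i + j, l + 1) C(l, i) C(l, j) / l · w(k, l),
-- and these coefficients are integers independent of k. Hence every coefficient of X^(r-1) w_k^(α)(x)^m is a
-- combination of the w(k, l) with integer coefficients that do not depend on k, and it remains to treat the
-- sums S = Σ_k (±1)^k X (2k + 1) w(k, l). They telescope, to closed forms from which n(n + 1) ∣ S and
-- n + 2 ∣ S are visible; since gcd(n(n + 1), n + 2) = (2, n), this makes (2, n) S divisible by n(n + 1)(n + 2).
module Submission where

open import Defs
import Algebra.Definitions.RawSemiring as RawSemiringDefinitions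
open import Data.Integer.Base as ℤ using (ℤ; +_; _+_; _*_; _-_; -_; 0ℤ; 1ℤ; -1ℤ)
open import Data.Integer.Divisibility.Signed as ℤ using (_∣_; divides)
import Data.Integer.Properties as ℤ
open import Data.Integer.Tactic.RingSolver using (solve)
open import Data.List.Base using ([]; _∷_; applyUpTo)
open import Data.Nat.Base as ℕ using (ℕ; zero; suc; NonZero)
import Data.Nat.Combinatorics as ℕ
import Data.Nat.Divisibility as ℕ
open import Data.Nat.DivMod using (_%_; m≡m%n+[m/n]*n; m%n<n) renaming (_/_ to _div_)
open import Data.Nat.GCD using (gcd; gcd-greatest)
import Data.Nat.Properties as ℕ
open import Data.Product.Base using (_×_; _,_; ∃-syntax)
open import Data.Rational.Base as ℚ using (ℚ; 0ℚ; fromℚᵘ; _/_)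
import Data.Rational.Properties as ℚ
open import Data.Rational.Unnormalised.Base as ℚᵘ using (mkℚᵘ; *≡*)
import Data.Rational.Unnormalised.Properties as ℚᵘ
open import Relation.Binary.Definitions using (tri<; tri≈; tri>)
open import Relation.Binary.PropositionalEquality
open import Relation.Nullary using (yes; no; contradiction)

open RawSemiringDefinitions ℚ.+-*-rawSemiring using () renaming (_^_ to _^ℚ_)
open ≡-Reasoning

-- Integer identities as linear combinations of hypotheses

infixl 7 _⊙_

_⊙_ : ∀ c {x y} → x ≡ y → c * (x - y) ≡ 0ℤ
c ⊙ eq = trans (cong (c *_) (ℤ.i≡j⇒i-j≡0 eq)) (ℤ.*-zeroʳ c)

-- e is a combination of differences x - y, one for each hypothesis x ≡ y; the second premise is a ring identity.
linear-combination : ∀ {x y e} → e ≡ 0ℤ → x - y ≡ e → x ≡ y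
linear-combination e≡0 eq = ℤ.i-j≡0⇒i≡j _ _ (trans eq e≡0)

infixl 6 _⊕_
_⊕_ : ∀ {x y} → x ≡ 0ℤ → y ≡ 0ℤ → x + y ≡ 0ℤ
_⊕_ = cong₂ _+_

-- Binomial coefficients over the integers

infix 8 _choose_

opaque
  -- Opaque, so that a binomial coefficient stays an atom in ring identities instead of unfolding.
  _choose_ : ℕ → ℕ → ℤ
  n choose k = + (n ℕ.C k)

  choose-def : ∀ n k → n choose k ≡ + (n ℕ.C k)
  choose-def n k = refl

choose-zero : ∀ {n k} → n ℕ.< k → n choose k ≡ 0ℤ
choose-zero n<k = trans (choose-def _ _) (cong +_ (ℕ.k>n⇒nCk≡0 n<k))

n-choose-0 : ∀ n → n choose 0 ≡ 1ℤ
n-choose-0 n = choose-def n 0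

n-choose-1 : ∀ n → n choose 1 ≡ + n
n-choose-1 n = trans (choose-def n 1) (cong +_ (ℕ.nC1≡n n))

n-choose-n : ∀ n → n choose n ≡ 1ℤ
n-choose-n n = trans (choose-def n n) (cong +_ (ℕ.nCn≡1 n))

opaque
  unfolding _choose_

  pascal : ∀ n k → suc n choose suc k ≡ n choose k + n choose suc k
  pascal n k = cong +_ (sym (ℕ.nCk+nC[k+1]≡[n+1]C[k+1] n k))

-- Pascal's rule splits the left side; the induction hypotheses at `k` and `suc k` are recombined by
-- Pascal's rule one row lower.
absorption : ∀ n k → + suc k * suc n choose suc k ≡ + suc n * n choose k
absorption n zero = begin
  1ℤ * suc n choose 1    ≡⟨ ℤ.*-identityˡ (suc n choose 1) ⟩
  suc n choose 1         ≡⟨ n-choose-1 (suc n) ⟩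
  + suc n                ≡⟨ ℤ.*-identityʳ (+ suc n) ⟨
  + suc n * 1ℤ           ≡⟨ cong (+ suc n *_) (n-choose-0 n) ⟨
  + suc n * n choose 0   ∎
absorption zero (suc k) = begin
  + suc (suc k) * 1 choose suc (suc k) ≡⟨ cong (+ suc (suc k) *_) (choose-zero (ℕ.s≤s (ℕ.s≤s ℕ.z≤n))) ⟩
  + suc (suc k) * 0ℤ                   ≡⟨ ℤ.*-zeroʳ (+ suc (suc k)) ⟩
  1ℤ * 0ℤ                              ≡⟨ cong (1ℤ *_) (choose-zero {0} {suc k} (ℕ.s≤s ℕ.z≤n)) ⟨
  1ℤ * 0 choose suc k                  ∎
absorption (suc n) (suc k) = algebra (+ n) (+ k) _ _ _ _ _
  (pascal (suc n) (suc k)) (pascal n k) (absorption n k) (absorption n (suc k))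
  where
  algebra : ∀ n k A B B′ d d′ → A ≡ B + B′ → B ≡ d + d′ →
            (1ℤ + k) * B ≡ (1ℤ + n) * d → (+ 2 + k) * B′ ≡ (1ℤ + n) * d′ →
            (+ 2 + k) * A ≡ (+ 2 + n) * B
  algebra n k A B B′ d d′ h₁ h₂ h₃ h₄ = linear-combination
    ((+ 2 + k) ⊙ h₁ ⊕ (- (1ℤ + n)) ⊙ h₂ ⊕ 1ℤ ⊙ h₃ ⊕ 1ℤ ⊙ h₄)
    (solve (n ∷ k ∷ A ∷ B ∷ B′ ∷ d ∷ d′ ∷ []))

-- The difference is taken in the integers, so the identity stays true past the diagonal: for
-- `k > n` both binomials vanish.
lower-step : ∀ n k → + suc k * n choose suc k ≡ (+ n - + k) * n choose k
lower-step n k = algebra (+ n) (+ k) _ _ _ (pascal n k) (absorption n k)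
  where
  algebra : ∀ n k A B B′ → A ≡ B + B′ → (1ℤ + k) * A ≡ (1ℤ + n) * B →
            (1ℤ + k) * B′ ≡ (n - k) * B
  algebra n k A B B′ h₁ h₂ = linear-combination
    ((- (1ℤ + k)) ⊙ h₁ ⊕ 1ℤ ⊙ h₂)
    (solve (n ∷ k ∷ A ∷ B ∷ B′ ∷ []))

upper-step : ∀ n k → (+ suc n - + k) * suc n choose k ≡ + suc n * n choose k
upper-step n zero    = cong₂ _*_ (ℤ.+-identityʳ (+ suc n)) (trans (n-choose-0 (suc n)) (sym (n-choose-0 n)))
upper-step n (suc k) = algebra (+ n) (+ k) _ _ _ (pascal n k) (lower-step n k)
  where
  algebra : ∀ n k A B B′ → A ≡ B + B′ → (1ℤ + k) * B′ ≡ (n - k) * B →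
            ((1ℤ + n) - (1ℤ + k)) * A ≡ (1ℤ + n) * B′
  algebra n k A B B′ h₁ h₂ = linear-combination
    ((n - k) ⊙ h₁ ⊕ (- 1ℤ) ⊙ h₂)
    (solve (n ∷ k ∷ A ∷ B ∷ B′ ∷ []))

-- The numbers w(k, j) and their recurrences

-- W K L is the number w(k, j) of the paper at k = K + 1 and j = L + 1, and X K is k(k + 1).
W : ℕ → ℕ → ℤ
W K L = K choose L * (suc K ℕ.+ suc L) choose suc L - suc K choose suc L * (suc K ℕ.+ suc L) choose L

X : ℕ → ℤ
X K = + suc K * + suc (suc K)

-- After multiplication by `suc L`, the two products in `W` become K + 2 and K + 1 times one and the
-- same product. This replaces division by j: later identities are multiplied by `suc L` and
-- cancelled.
[1+L]*W : ∀ K L → + suc L * W K L ≡ K choose L * (suc K ℕ.+ suc L) choose L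
[1+L]*W K L = algebra (+ K) (+ L) _ _ _ _ (absorption K L) (lower-step (suc K ℕ.+ suc L) L)
  where
  algebra : ∀ k l a A c C → (1ℤ + l) * A ≡ (1ℤ + k) * a →
            (1ℤ + l) * C ≡ ((1ℤ + k) + (1ℤ + l) - l) * c → (1ℤ + l) * (a * C - A * c) ≡ a * c
  algebra k l a A c C h₁ h₂ = linear-combination
    (a ⊙ h₂ ⊕ (- c) ⊙ h₁)
    (solve (k ∷ l ∷ a ∷ A ∷ c ∷ C ∷ []))

W-zero : ∀ {K L} → K ℕ.< L → W K L ≡ 0ℤ
W-zero {K} {L} K<L = cong₂ (λ a b → a * (suc K ℕ.+ suc L) choose suc L - b * (suc K ℕ.+ suc L) choose L)
  (choose-zero K<L) (choose-zero (ℕ.s≤s K<L))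

W-first : ∀ K → W K 0 ≡ 1ℤ
W-first K = begin
  W K 0                                  ≡⟨ ℤ.*-identityˡ (W K 0) ⟨
  1ℤ * W K 0                             ≡⟨ [1+L]*W K 0 ⟩
  K choose 0 * (suc K ℕ.+ 1) choose 0    ≡⟨ cong₂ _*_ (n-choose-0 K) (n-choose-0 (suc K ℕ.+ 1)) ⟩
  1ℤ                                     ∎

-- The ratio of `W K (suc L)` to `W K L` is (K - L)(K + L + 3) / ((L + 1)(L + 2)), and (K - L)(K + L
-- + 3) = X K - (L + 1)(L + 2).
W-step : ∀ K L → X K * W K L ≡ (+ suc L * + suc (suc L)) * (W K L + W K (suc L))
W-step K L = ℤ.*-cancelˡ-≡ (+ suc L) _ _
  (algebra (+ K) (+ L) _ _ _ _ ([1+L]*W K L) [2+L]*W′ (lower-step K L) (absorption (suc K ℕ.+ suc L) L))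
  where
  [2+L]*W′ : + suc (suc L) * W K (suc L) ≡ K choose suc L * suc (suc K ℕ.+ suc L) choose suc L
  [2+L]*W′ = trans ([1+L]*W K (suc L))
    (cong (λ t → K choose suc L * t choose suc L) (ℕ.+-suc (suc K) (suc L)))
  algebra : ∀ k l a a′ c c′ {w w′} → (1ℤ + l) * w ≡ a * c → (+ 2 + l) * w′ ≡ a′ * c′ →
            (1ℤ + l) * a′ ≡ (k - l) * a → (1ℤ + l) * c′ ≡ (1ℤ + ((1ℤ + k) + (1ℤ + l))) * c →
            (1ℤ + l) * (((1ℤ + k) * (+ 2 + k)) * w) ≡ (1ℤ + l) * (((1ℤ + l) * (+ 2 + l)) * (w + w′))
  algebra k l a a′ c c′ {w} {w′} h₁ h₂ h₃ h₄ = linear-combination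
    (((k - l) * (+ 3 + k + l)) ⊙ h₁ ⊕ (- ((1ℤ + l) * (1ℤ + l))) ⊙ h₂
      ⊕ (- ((1ℤ + l) * c′)) ⊙ h₃ ⊕ (- ((k - l) * a)) ⊙ h₄)
    (solve (k ∷ l ∷ a ∷ a′ ∷ c ∷ c′ ∷ w ∷ w′ ∷ []))

-- The ratio of neighbours in the first index, cleared of denominators; it drives the telescoping of
-- the sums over K.
W-shift : ∀ N L → ((+ suc N - + L) * + suc (suc (suc N))) * W (suc N) L ≡ (+ (3 ℕ.+ N ℕ.+ L) * + suc N) * W N L
W-shift N L = ℤ.*-cancelˡ-≡ (+ suc L) _ _
  (algebra (+ N) (+ L) _ _ _ _ ([1+L]*W N L) ([1+L]*W (suc N) L) (upper-step N L) (upper-step (suc N ℕ.+ suc L) L))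
  where
  algebra : ∀ n l a a′ c c′ {w w′} → (1ℤ + l) * w ≡ a * c → (1ℤ + l) * w′ ≡ a′ * c′ →
            ((1ℤ + n) - l) * a′ ≡ (1ℤ + n) * a →
            ((1ℤ + ((1ℤ + n) + (1ℤ + l))) - l) * c′ ≡ (1ℤ + ((1ℤ + n) + (1ℤ + l))) * c →
            (1ℤ + l) * ((((1ℤ + n) - l) * (+ 3 + n)) * w′) ≡ (1ℤ + l) * (((+ 3 + n + l) * (1ℤ + n)) * w)
  algebra n l a a′ c c′ {w} {w′} h₁ h₂ h₃ h₄ = linear-combination
    ((- ((+ 3 + n + l) * (1ℤ + n))) ⊙ h₁ ⊕ ((1ℤ + n - l) * (+ 3 + n)) ⊙ h₂
      ⊕ ((+ 3 + n) * c′) ⊙ h₃ ⊕ ((1ℤ + n) * a) ⊙ h₄)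
    (solve (n ∷ l ∷ a ∷ a′ ∷ c ∷ c′ ∷ w ∷ w′ ∷ []))

-- Finite sums of integers

∑ : ℕ → (ℕ → ℤ) → ℤ
∑ zero    f = 0ℤ
∑ (suc n) f = ∑ n f + f n

∑-cong : ∀ n {f g : ℕ → ℤ} → (∀ i → i ℕ.< n → f i ≡ g i) → ∑ n f ≡ ∑ n g
∑-cong zero    eq = refl
∑-cong (suc n) eq = cong₂ _+_ (∑-cong n (λ i i<n → eq i (ℕ.m<n⇒m<1+n i<n))) (eq n (ℕ.n<1+n n))

∑-zero : ∀ n → ∑ n (λ _ → 0ℤ) ≡ 0ℤ
∑-zero zero    = refl
∑-zero (suc n) = cong (_+ 0ℤ) (∑-zero n)

∑-distrib-+ : ∀ n (f g : ℕ → ℤ) → ∑ n (λ i → f i + g i) ≡ ∑ n f + ∑ n g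
∑-distrib-+ zero    f g = refl
∑-distrib-+ (suc n) f g = trans (cong (_+ (f n + g n)) (∑-distrib-+ n f g)) (algebra (∑ n f) (∑ n g) (f n) (g n))
  where
  algebra : ∀ a b c d → a + b + (c + d) ≡ a + c + (b + d)
  algebra a b c d = solve (a ∷ b ∷ c ∷ d ∷ [])

*-distribˡ-∑ : ∀ n z (f : ℕ → ℤ) → z * ∑ n f ≡ ∑ n (λ i → z * f i)
*-distribˡ-∑ zero    z f = ℤ.*-zeroʳ z
*-distribˡ-∑ (suc n) z f = trans (ℤ.*-distribˡ-+ z (∑ n f) (f n)) (cong (_+ z * f n) (*-distribˡ-∑ n z f))

*-distribʳ-∑ : ∀ n z (f : ℕ → ℤ) → ∑ n f * z ≡ ∑ n (λ i → f i * z)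
*-distribʳ-∑ n z f = trans (ℤ.*-comm (∑ n f) z)
  (trans (*-distribˡ-∑ n z f) (∑-cong n (λ i _ → ℤ.*-comm z (f i))))

∑-swap : ∀ m n (f : ℕ → ℕ → ℤ) → ∑ m (λ i → ∑ n (f i)) ≡ ∑ n (λ j → ∑ m (λ i → f i j))
∑-swap zero    n f = sym (∑-zero n)
∑-swap (suc m) n f = trans (cong (_+ ∑ n (f m)) (∑-swap m n f)) (sym (∑-distrib-+ n _ (f m)))

∑-single : ∀ n {f : ℕ → ℤ} J → (∀ L → L ≢ J → f L ≡ 0ℤ) → (n ℕ.≤ J → f J ≡ 0ℤ) → ∑ n f ≡ f J
∑-single zero    J f≡0 beyond = sym (beyond ℕ.z≤n)
∑-single (suc n) {f} J f≡0 beyond with n ℕ.≟ J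
... | no n≢J = trans (cong₂ _+_ (∑-single n J f≡0 beyond′) (f≡0 n n≢J)) (ℤ.+-identityʳ (f J))
  where
  beyond′ : n ℕ.≤ J → f J ≡ 0ℤ
  beyond′ n≤J = beyond (ℕ.≤∧≢⇒< n≤J n≢J)
... | yes refl = trans
  (cong (_+ f n) (trans (∑-cong n (λ L L<n → f≡0 L (ℕ.<⇒≢ L<n))) (∑-zero n)))
  (ℤ.+-identityˡ (f n))

-- Products of the w(k, j) as integer combinations of the w(k, l)

-- With i = I + 1, j = J + 1, l = L + 1: the coefficient C(i + j, l + 1) C(l, i) C(l, j) / l of the header. Integrality:
-- (l + 1) C(i + j, l + 1) = (i + j - l) C(i + j, l), while i C(l, i) = l C(l - 1, i - 1), and likewise for j.
D : ℕ → ℕ → ℕ → ℤ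
D I J L =
  (L choose I * suc L choose suc J + suc L choose suc I * L choose J - suc L choose suc I * suc L choose suc J)
    * (suc I ℕ.+ suc J) choose suc L
  - (suc I ℕ.+ suc J) choose suc (suc L) * (suc L choose suc I * suc L choose suc J)

-- Times `suc L`, the bracket in `D` becomes i + j - l times a product of two binomials. By
-- `lower-step` the first term is then l + 1 copies of the right side, and the subtracted term is l
-- copies.
[1+L]*D : ∀ I J L → + suc L * D I J L ≡ (suc I ℕ.+ suc J) choose suc (suc L) * (suc L choose suc I * suc L choose suc J)
[1+L]*D I J L = algebra (+ I) (+ J) (+ L) _ _ _ _ _ _ (absorption L I) (absorption L J) (lower-step (suc I ℕ.+ suc J) (suc L))
  where
  algebra : ∀ i j l a₀ a b₀ b H G → (1ℤ + i) * a ≡ (1ℤ + l) * a₀ → (1ℤ + j) * b ≡ (1ℤ + l) * b₀ →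
            (+ 2 + l) * G ≡ (((1ℤ + i) + (1ℤ + j)) - (1ℤ + l)) * H →
            (1ℤ + l) * ((a₀ * b + a * b₀ - a * b) * H - G * (a * b)) ≡ G * (a * b)
  algebra i j l a₀ a b₀ b H G h₁ h₂ h₃ = linear-combination
    ((- (b * H)) ⊙ h₁ ⊕ (- (a * H)) ⊙ h₂ ⊕ (- (a * b)) ⊙ h₃)
    (solve (i ∷ j ∷ l ∷ a₀ ∷ a ∷ b₀ ∷ b ∷ H ∷ G ∷ []))

-- L * (L + 1) * D I J (L - 1), in a form that also makes sense at L = 0.
carry : ℕ → ℕ → ℕ → ℤ
carry I J L = + suc L * ((suc I ℕ.+ suc J) choose suc L * (L choose suc I * L choose suc J))

carry-suc : ∀ I J L → carry I J (suc L) ≡ + suc (suc L) * (+ suc L * D I J L)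
carry-suc I J L = cong (+ suc (suc L) *_) (sym ([1+L]*D I J L))

-- Compares coefficients of `W K L` when the expansion for `I` is multiplied by X - i(i + 1). By
-- `W-step`, the term at L contributes l(l + 1) - i(i + 1) = (L - I)(L + I + 3), and the term at L -
-- 1 contributes `carry`.
D-step : ∀ I J L → (+ suc I * + suc (suc I)) * D (suc I) J L ≡ ((+ L - + I) * + (3 ℕ.+ L ℕ.+ I)) * D I J L + carry I J L
D-step I J L = ℤ.*-cancelˡ-≡ (+ suc L) _ _
  (algebra (+ I) (+ J) (+ L) _ _ _ _ _ _ _ _ ([1+L]*D (suc I) J L) ([1+L]*D I J L)
    (pascal (suc I ℕ.+ suc J) (suc L)) (lower-step (suc L) (suc I))
    (upper-step L (suc I)) (upper-step L (suc J)) (lower-step (suc I ℕ.+ suc J) (suc L)))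
  where
  algebra : ∀ i j l H G G′ a₀ a a₂ b₀ b {d d′} →
            (1ℤ + l) * d′ ≡ G′ * (a₂ * b) → (1ℤ + l) * d ≡ G * (a * b) → G′ ≡ H + G →
            (+ 2 + i) * a₂ ≡ ((1ℤ + l) - (1ℤ + i)) * a →
            ((1ℤ + l) - (1ℤ + i)) * a ≡ (1ℤ + l) * a₀ → ((1ℤ + l) - (1ℤ + j)) * b ≡ (1ℤ + l) * b₀ →
            (+ 2 + l) * G ≡ (((1ℤ + i) + (1ℤ + j)) - (1ℤ + l)) * H →
            (1ℤ + l) * (((1ℤ + i) * (+ 2 + i)) * d′)
              ≡ (1ℤ + l) * (((l - i) * (+ 3 + l + i)) * d + (1ℤ + l) * (H * (a₀ * b₀)))
  algebra i j l H G G′ a₀ a a₂ b₀ b {d} {d′} h₁ h₂ h₃ h₄ h₅ h₆ h₇ = linear-combination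
    (((1ℤ + i) * (+ 2 + i)) ⊙ h₁ ⊕ (- ((l - i) * (+ 3 + l + i))) ⊙ h₂
      ⊕ ((1ℤ + i) * (+ 2 + i) * a₂ * b) ⊙ h₃ ⊕ ((1ℤ + i) * (H + G) * b) ⊙ h₄
      ⊕ (H * (1ℤ + l) * b₀) ⊙ h₅ ⊕ (H * (l - i) * a) ⊙ h₆ ⊕ (- ((l - i) * a * b)) ⊙ h₇)
    (solve (i ∷ j ∷ l ∷ H ∷ G ∷ G′ ∷ a₀ ∷ a ∷ a₂ ∷ b₀ ∷ b ∷ d ∷ d′ ∷ []))

-- With `D-first-≡`, this makes `D 0 J` the Kronecker delta at J: one of the binomials vanishes on
-- either side of the diagonal.
D-first-≢ : ∀ J L → L ≢ J → D 0 J L ≡ 0ℤ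
D-first-≢ J L L≢J = ℤ.*-cancelˡ-≡ (+ suc L) _ _
  (trans ([1+L]*D 0 J L) (trans vanishing (sym (ℤ.*-zeroʳ (+ suc L)))))
  where
  vanishing : suc (suc J) choose suc (suc L) * (suc L choose 1 * suc L choose suc J) ≡ 0ℤ
  vanishing with ℕ.<-cmp L J
  ... | tri< L<J _ _ = trans
    (cong (λ z → suc (suc J) choose suc (suc L) * (suc L choose 1 * z)) (choose-zero (ℕ.s≤s L<J)))
    (trans (cong (suc (suc J) choose suc (suc L) *_) (ℤ.*-zeroʳ (suc L choose 1)))
      (ℤ.*-zeroʳ (suc (suc J) choose suc (suc L))))
  ... | tri≈ _ L≡J _ = contradiction L≡J L≢J
  ... | tri> _ _ J<L = cong (_* (suc L choose 1 * suc L choose suc J)) (choose-zero (ℕ.s≤s (ℕ.s≤s J<L)))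

D-first-≡ : ∀ J → D 0 J J ≡ 1ℤ
D-first-≡ J = ℤ.*-cancelˡ-≡ (+ suc J) _ _ (begin
  + suc J * D 0 J J
    ≡⟨ [1+L]*D 0 J J ⟩
  suc (suc J) choose suc (suc J) * (suc J choose 1 * suc J choose suc J)
    ≡⟨ cong₂ (λ a b → a * (suc J choose 1 * b)) (n-choose-n (suc (suc J))) (n-choose-n (suc J)) ⟩
  1ℤ * (suc J choose 1 * 1ℤ)
    ≡⟨ ℤ.*-identityˡ (suc J choose 1 * 1ℤ) ⟩
  suc J choose 1 * 1ℤ
    ≡⟨ cong (_* 1ℤ) (n-choose-1 (suc J)) ⟩
  + suc J * 1ℤ
    ∎)

-- The truncated form of multiplication by X - i(i + 1). The `carry` term is what `W-step` pushes
-- from index n - 1 to index n, outside the range of the sum.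
∑-D-step : ∀ I J K n → (+ suc I * + suc (suc I)) * ∑ n (λ L → D (suc I) J L * W K L) + carry I J n * W K n
  ≡ (X K - + suc I * + suc (suc I)) * ∑ n (λ L → D I J L * W K L)
∑-D-step I J K zero = trans (cong₂ _+_ (ℤ.*-zeroʳ (+ suc I * + suc (suc I))) carry-zero)
  (sym (ℤ.*-zeroʳ (X K - + suc I * + suc (suc I))))
  where
  carry-zero : carry I J 0 * W K 0 ≡ 0ℤ
  carry-zero = trans
    (cong (λ z → 1ℤ * ((suc I ℕ.+ suc J) choose 1 * (z * 0 choose suc J)) * W K 0) (choose-zero {0} {suc I} (ℕ.s≤s ℕ.z≤n)))
    (cong (λ z → 1ℤ * z * W K 0) (ℤ.*-zeroʳ ((suc I ℕ.+ suc J) choose 1)))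
∑-D-step I J K (suc L) = algebra (+ I) (+ L) (X K) (∑ L (λ L → D I J L * W K L)) (∑ L (λ L → D (suc I) J L * W K L))
  (D I J L) (D (suc I) J L) (carry I J L) (carry I J (suc L)) (W K L) (W K (suc L))
  (∑-D-step I J K L) (D-step I J L) (W-step K L) (carry-suc I J L)
  where
  algebra : ∀ i l x s s′ d d′ e e′ w w′ →
            ((1ℤ + i) * (+ 2 + i)) * s′ + e * w ≡ (x - (1ℤ + i) * (+ 2 + i)) * s →
            ((1ℤ + i) * (+ 2 + i)) * d′ ≡ ((l - i) * (+ 3 + l + i)) * d + e →
            x * w ≡ ((1ℤ + l) * (+ 2 + l)) * (w + w′) →
            e′ ≡ (+ 2 + l) * ((1ℤ + l) * d) →
            ((1ℤ + i) * (+ 2 + i)) * (s′ + d′ * w) + e′ * w′ ≡ (x - (1ℤ + i) * (+ 2 + i)) * (s + d * w)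
  algebra i l x s s′ d d′ e e′ w w′ h₁ h₂ h₃ h₄ = linear-combination
    (1ℤ ⊙ h₁ ⊕ w ⊙ h₂ ⊕ (- d) ⊙ h₃ ⊕ w′ ⊙ h₄)
    (solve (i ∷ l ∷ x ∷ s ∷ s′ ∷ d ∷ d′ ∷ e ∷ e′ ∷ w ∷ w′ ∷ []))

-- Induction on `I`: `W-step` gives i(i + 1) w(k, i + 1) = (X - i(i + 1)) w(k, i), and `∑-D-step`
-- does the same to the sum. Its boundary term vanishes since `K < n`.
W-product : ∀ {K n} I J → K ℕ.< n → W K I * W K J ≡ ∑ n (λ L → D I J L * W K L)
W-product {K} {n} zero J K<n = trans
  (cong (_* W K J) (trans (W-first K) (sym (D-first-≡ J))))
  (sym (∑-single n J
    (λ L L≢J → cong (_* W K L) (D-first-≢ J L L≢J))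
    -- For `n ≤ J` the index J is missing from the sum, but then `K < J` and `W K J` is zero.
    (λ n≤J → trans (cong (D 0 J J *_) (W-zero (ℕ.<-≤-trans K<n n≤J))) (ℤ.*-zeroʳ (D 0 J J)))))
W-product {K} {n} (suc I) J K<n = ℤ.*-cancelˡ-≡ (+ suc I * + suc (suc I)) _ _
  (algebra (+ I) (X K) (W K I) (W K (suc I)) (W K J) (W K n) (carry I J n)
    (∑ n (λ L → D I J L * W K L)) (∑ n (λ L → D (suc I) J L * W K L))
    (W-product I J K<n) (∑-D-step I J K n) (W-step K I) (W-zero K<n))
  where
  algebra : ∀ i x w w′ v z e s s′ → w * v ≡ s →
            ((1ℤ + i) * (+ 2 + i)) * s′ + e * z ≡ (x - (1ℤ + i) * (+ 2 + i)) * s →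
            x * w ≡ ((1ℤ + i) * (+ 2 + i)) * (w + w′) → z ≡ 0ℤ →
            ((1ℤ + i) * (+ 2 + i)) * (w′ * v) ≡ ((1ℤ + i) * (+ 2 + i)) * s′
  algebra i x w w′ v z e s s′ h₁ h₂ h₃ h₄ = linear-combination
    ((x - (1ℤ + i) * (+ 2 + i)) ⊙ h₁ ⊕ (- 1ℤ) ⊙ h₂ ⊕ (- v) ⊙ h₃ ⊕ e ⊙ h₄)
    (solve (i ∷ x ∷ w ∷ w′ ∷ v ∷ z ∷ e ∷ s ∷ s′ ∷ []))

-- Closed forms and divisibility of the sums over k

-- The factor 3 + (K + K) is 2k + 1 at k = K + 1.
X-summand : ℕ → ℕ → ℤ
X-summand L K = (X K * + (3 ℕ.+ (K ℕ.+ K))) * W K L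

-- Base case of both closed forms: at N = 0 the two sides differ by a multiple of `+ L * W 0 L`.
L*W-zero : ∀ L → + L * W 0 L ≡ 0ℤ
L*W-zero zero    = refl
L*W-zero (suc L) = trans (cong (+ suc L *_) (W-zero {0} (ℕ.s≤s ℕ.z≤n))) (ℤ.*-zeroʳ (+ suc L))

-- With n = N + 1 and l = L + 1, the sum is (n + 1)(n + l + 1) / (l + 1) times n(n + 1) w(n, l). By
-- `W-shift`, consecutive values differ by the new summand.
[2+L]*∑ : ∀ N L → + (2 ℕ.+ L) * ∑ (suc N) (X-summand L)
  ≡ (+ (2 ℕ.+ N) * + (3 ℕ.+ N ℕ.+ L)) * (X N * W N L)
[2+L]*∑ zero    L = algebra (+ L) (W 0 L) (L*W-zero L)
  where
  algebra : ∀ l w → l * w ≡ 0ℤ → (+ 2 + l) * (0ℤ + + 6 * w) ≡ (+ 2 * (+ 3 + l)) * (+ 2 * w)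
  algebra l w h = linear-combination (+ 2 ⊙ h) (solve (l ∷ w ∷ []))
[2+L]*∑ (suc N) L = algebra (+ N) (+ L) (∑ (suc N) (X-summand L)) (W N L) (W (suc N) L) ([2+L]*∑ N L) (W-shift N L)
  where
  algebra : ∀ n l S w w′ →
            (+ 2 + l) * S ≡ ((+ 2 + n) * (+ 3 + n + l)) * (((1ℤ + n) * (+ 2 + n)) * w) →
            (((1ℤ + n) - l) * (+ 3 + n)) * w′ ≡ ((+ 3 + n + l) * (1ℤ + n)) * w →
            (+ 2 + l) * (S + (((+ 2 + n) * (+ 3 + n)) * (+ 3 + ((1ℤ + n) + (1ℤ + n)))) * w′)
              ≡ ((+ 3 + n) * (+ 4 + n + l)) * (((+ 2 + n) * (+ 3 + n)) * w′)
  algebra n l S w w′ h₁ h₂ = linear-combination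
    (1ℤ ⊙ h₁ ⊕ (- ((+ 2 + n) * (+ 2 + n))) ⊙ h₂)
    (solve (n ∷ l ∷ S ∷ w ∷ w′ ∷ []))

-- Here consecutive values of (n + l + 1) n(n + 1) w(n, l) add up to the new summand, so the signed
-- values telescope.
∑-alternating : ∀ N L → ∑ (suc N) (λ K → -1ℤ ℤ.^ suc K * X-summand L K)
  ≡ -1ℤ ℤ.^ suc N * (+ (3 ℕ.+ N ℕ.+ L) * (X N * W N L))
∑-alternating zero    L = algebra (+ L) (W 0 L) (L*W-zero L)
  where
  algebra : ∀ l w → l * w ≡ 0ℤ → 0ℤ + -1ℤ * (+ 6 * w) ≡ -1ℤ * ((+ 3 + l) * (+ 2 * w))
  algebra l w h = linear-combination (+ 2 ⊙ h) (solve (l ∷ w ∷ []))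
∑-alternating (suc N) L = algebra (+ N) (+ L) (∑ (suc N) (λ K → -1ℤ ℤ.^ suc K * X-summand L K)) (-1ℤ ℤ.^ suc N)
  (W N L) (W (suc N) L) (∑-alternating N L) (W-shift N L)
  where
  algebra : ∀ n l S s w w′ →
            S ≡ s * ((+ 3 + n + l) * (((1ℤ + n) * (+ 2 + n)) * w)) →
            (((1ℤ + n) - l) * (+ 3 + n)) * w′ ≡ ((+ 3 + n + l) * (1ℤ + n)) * w →
            S + (-1ℤ * s) * ((((+ 2 + n) * (+ 3 + n)) * (+ 3 + ((1ℤ + n) + (1ℤ + n)))) * w′)
              ≡ (-1ℤ * s) * ((+ 4 + n + l) * (((+ 2 + n) * (+ 3 + n)) * w′))
  algebra n l S s w w′ h₁ h₂ = linear-combination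
    (1ℤ ⊙ h₁ ⊕ (- (s * (+ 2 + n))) ⊙ h₂)
    (solve (n ∷ l ∷ S ∷ s ∷ w ∷ w′ ∷ []))

-- Lets the denominator l + 1 of the unsigned closed form cancel while its factor n(n + 1) remains.
W-factor₁ : ∀ N L → (+ (2 ℕ.+ N) * + (3 ℕ.+ N ℕ.+ L)) * W N L
  ≡ + (2 ℕ.+ L) * (N choose L * suc (suc N ℕ.+ suc L) choose (2 ℕ.+ L))
W-factor₁ N L = ℤ.*-cancelˡ-≡ (+ suc L) _ _
  (algebra (+ N) (+ L) (N choose L) _ _ _ ([1+L]*W N L) (lower-step (suc N ℕ.+ suc L) L) (absorption (suc N ℕ.+ suc L) (suc L)))
  where
  algebra : ∀ n l a c c₁ c₂ {w} → (1ℤ + l) * w ≡ a * c →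
            (1ℤ + l) * c₁ ≡ (((1ℤ + n) + (1ℤ + l)) - l) * c →
            (+ 2 + l) * c₂ ≡ (1ℤ + ((1ℤ + n) + (1ℤ + l))) * c₁ →
            (1ℤ + l) * (((+ 2 + n) * (+ 3 + n + l)) * w) ≡ (1ℤ + l) * ((+ 2 + l) * (a * c₂))
  algebra n l a c c₁ c₂ {w} h₁ h₂ h₃ = linear-combination
    (((+ 2 + n) * (+ 3 + n + l)) ⊙ h₁ ⊕ (- (a * (+ 3 + n + l))) ⊙ h₂ ⊕ (- ((1ℤ + l) * a)) ⊙ h₃)
    (solve (n ∷ l ∷ a ∷ c ∷ c₁ ∷ c₂ ∷ w ∷ []))

-- Exposes n + 2 in both closed forms: n(n + 1) C(n - 1, l - 1) = l(l + 1) C(n + 1, l + 1), and (n +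
-- l + 1) C(n + l, l - 1) = (n + 2) C(n + l + 1, l - 1).
W-factor₂ : ∀ N L → + (3 ℕ.+ N ℕ.+ L) * (X N * W N L)
  ≡ (+ (3 ℕ.+ N) * + (2 ℕ.+ L)) * (suc (suc N ℕ.+ suc L) choose L * (2 ℕ.+ N) choose (2 ℕ.+ L))
W-factor₂ N L = ℤ.*-cancelˡ-≡ (+ suc L) _ _
  (algebra (+ N) (+ L) (N choose L) _ ((2 ℕ.+ N) choose (2 ℕ.+ L)) _ _ ([1+L]*W N L) (upper-step (suc N ℕ.+ suc L) L)
    (absorption N L) (absorption (suc N) (suc L)))
  where
  algebra : ∀ n l a a₁ a₂ c c′ {w} → (1ℤ + l) * w ≡ a * c →
            ((1ℤ + ((1ℤ + n) + (1ℤ + l))) - l) * c′ ≡ (1ℤ + ((1ℤ + n) + (1ℤ + l))) * c →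
            (1ℤ + l) * a₁ ≡ (1ℤ + n) * a → (+ 2 + l) * a₂ ≡ (+ 2 + n) * a₁ →
            (1ℤ + l) * ((+ 3 + n + l) * (((1ℤ + n) * (+ 2 + n)) * w))
              ≡ (1ℤ + l) * (((+ 3 + n) * (+ 2 + l)) * (c′ * a₂))
  algebra n l a a₁ a₂ c c′ {w} h₁ h₂ h₃ h₄ = linear-combination
    (((+ 3 + n + l) * ((1ℤ + n) * (+ 2 + n))) ⊙ h₁ ⊕ (- ((1ℤ + l) * (+ 2 + l) * a₂)) ⊙ h₂
      ⊕ (- ((+ 3 + n + l) * (+ 2 + n) * c)) ⊙ h₃ ⊕ (- ((1ℤ + l) * (+ 3 + n + l) * c)) ⊙ h₄)
    (solve (n ∷ l ∷ a ∷ a₁ ∷ a₂ ∷ c ∷ c′ ∷ w ∷ []))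

X∣∑ : ∀ N L → X N ∣ ∑ (suc N) (X-summand L)
X∣∑ N L = divides (N choose L * suc (suc N ℕ.+ suc L) choose (2 ℕ.+ L))
  (ℤ.*-cancelˡ-≡ (+ (2 ℕ.+ L)) _ _ 
    (algebra (+ L) _ (+ (2 ℕ.+ N) * + (3 ℕ.+ N ℕ.+ L)) (X N) (W N L) _ ([2+L]*∑ N L) (W-factor₁ N L)))
  where
  algebra : ∀ l S p x w z → (+ 2 + l) * S ≡ p * (x * w) → p * w ≡ (+ 2 + l) * z →
            (+ 2 + l) * S ≡ (+ 2 + l) * (z * x)
  algebra l S p x w z h₁ h₂ = linear-combination (1ℤ ⊙ h₁ ⊕ x ⊙ h₂) (solve (l ∷ S ∷ p ∷ x ∷ w ∷ z ∷ []))

[3+N]∣∑ : ∀ N L → + (3 ℕ.+ N) ∣ ∑ (suc N) (X-summand L)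
[3+N]∣∑ N L = divides
  (+ (2 ℕ.+ N) * (suc (suc N ℕ.+ suc L) choose L * (2 ℕ.+ N) choose (2 ℕ.+ L)))
  (ℤ.*-cancelˡ-≡ (+ (2 ℕ.+ L)) _ _
  (algebra (+ N) (+ L) _ (+ (3 ℕ.+ N ℕ.+ L)) (X N * W N L) _ ([2+L]*∑ N L) (W-factor₂ N L)))
  where
  algebra : ∀ n l S p y z → (+ 2 + l) * S ≡ ((+ 2 + n) * p) * y → p * y ≡ ((+ 3 + n) * (+ 2 + l)) * z →
            (+ 2 + l) * S ≡ (+ 2 + l) * (((+ 2 + n) * z) * (+ 3 + n))
  algebra n l S p y z h₁ h₂ = linear-combination (1ℤ ⊙ h₁ ⊕ (+ 2 + n) ⊙ h₂) (solve (n ∷ l ∷ S ∷ p ∷ y ∷ z ∷ []))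

X∣∑-alternating : ∀ N L → X N ∣ ∑ (suc N) (λ K → -1ℤ ℤ.^ suc K * X-summand L K)
X∣∑-alternating N L = subst (X N ∣_) (sym (∑-alternating N L))
  (ℤ.∣n⇒∣m*n (-1ℤ ℤ.^ suc N) (ℤ.∣n⇒∣m*n (+ (3 ℕ.+ N ℕ.+ L)) (ℤ.∣m⇒∣m*n (W N L) ℤ.∣-refl)))

[3+N]∣∑-alternating : ∀ N L → + (3 ℕ.+ N) ∣ ∑ (suc N) (λ K → -1ℤ ℤ.^ suc K * X-summand L K)
[3+N]∣∑-alternating N L = subst (+ (3 ℕ.+ N) ∣_) (sym (∑-alternating N L))
  (ℤ.∣n⇒∣m*n (-1ℤ ℤ.^ suc N) (subst (+ (3 ℕ.+ N) ∣_) (sym (W-factor₂ N L))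
    (ℤ.∣m⇒∣m*n (suc (suc N ℕ.+ suc L) choose L * (2 ℕ.+ N) choose (2 ℕ.+ L))
      (ℤ.∣m⇒∣m*n (+ (2 ℕ.+ L)) ℤ.∣-refl))))

-- Combining the two divisors

-- Uses n (n + 1) - (n - 1) (n + 2) = 2.
2*-divisible : ∀ N {S} → X N ∣ S → + (3 ℕ.+ N) ∣ S → X N * + (3 ℕ.+ N) ∣ + 2 * S
2*-divisible N {S} (divides u S≡u*x) (divides v S≡v*y) =
  divides (v - + N * u) (algebra (+ N) S u v S≡u*x S≡v*y)
  where
  algebra : ∀ n S u v → S ≡ u * ((1ℤ + n) * (+ 2 + n)) → S ≡ v * (+ 3 + n) →
            + 2 * S ≡ (v - n * u) * (((1ℤ + n) * (+ 2 + n)) * (+ 3 + n))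
  algebra n S u v h₁ h₂ = linear-combination
    ((- (n * (+ 3 + n))) ⊙ h₁ ⊕ ((1ℤ + n) * (+ 2 + n)) ⊙ h₂)
    (solve (n ∷ S ∷ u ∷ v ∷ []))

-- For n = 2t + 1, S = (n + 2) S - (t + 1) (2 S). The first term is divisible because n(n + 1)
-- divides S, the second by `2*-divisible`.
odd-divisible : ∀ N t {S} → + suc N ≡ 1ℤ + + t * + 2 → X N ∣ S → + (3 ℕ.+ N) ∣ S → X N * + (3 ℕ.+ N) ∣ S
odd-divisible N t {S} odd x∣S@(divides u S≡u*x) y∣S with 2*-divisible N x∣S y∣S
... | divides q 2*S≡q*xy = divides (u - (1ℤ + + t) * q) (algebra (+ N) (+ t) S u q odd S≡u*x 2*S≡q*xy)
  where
  algebra : ∀ n t S u q → 1ℤ + n ≡ 1ℤ + t * + 2 → S ≡ u * ((1ℤ + n) * (+ 2 + n)) →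
            + 2 * S ≡ q * (((1ℤ + n) * (+ 2 + n)) * (+ 3 + n)) →
            S ≡ (u - (1ℤ + t) * q) * (((1ℤ + n) * (+ 2 + n)) * (+ 3 + n))
  algebra n t S u q h₁ h₂ h₃ = linear-combination
    ((- S) ⊙ h₁ ⊕ (+ 3 + n) ⊙ h₂ ⊕ (- (1ℤ + t)) ⊙ h₃)
    (solve (n ∷ t ∷ S ∷ u ∷ q ∷ []))

-- For even n the gcd is a multiple of 2 and `2*-divisible` applies; for odd n, S itself is
-- divisible.
gcd-divisible : ∀ N {S} → X N ∣ S → + (3 ℕ.+ N) ∣ S → X N * + (3 ℕ.+ N) ∣ + gcd 2 (suc N) * S
gcd-divisible N {S} x∣S y∣S
  with suc N % 2 | m≡m%n+[m/n]*n (suc N) 2 | m%n<n (suc N) 2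
... | zero  | even | _ = even-case (gcd-greatest ℕ.∣-refl (ℕ.divides (suc N div 2) even))
  where
  even-case : 2 ℕ.∣ gcd 2 (suc N) → X N * + (3 ℕ.+ N) ∣ + gcd 2 (suc N) * S
  even-case (ℕ.divides q eq) = subst (X N * + (3 ℕ.+ N) ∣_)
    (trans (sym (ℤ.*-assoc (+ q) (+ 2) S)) (cong (_* S) (trans (sym (ℤ.pos-* q 2)) (cong +_ (sym eq)))))
    (ℤ.∣n⇒∣m*n (+ q) (2*-divisible N x∣S y∣S))
... | suc zero | odd | _ = ℤ.∣n⇒∣m*n (+ gcd 2 (suc N))
  (odd-divisible N (suc N div 2) (trans (cong +_ odd) (cong (λ z → 1ℤ + z) (ℤ.pos-* (suc N div 2) 2))) x∣S y∣S)
... | suc (suc _) | _ | ℕ.s≤s (ℕ.s≤s ())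

-- The ring spanned by the functions K ↦ w(K + 1, l)

-- The coefficients do not depend on K: this is what lets a sum over K be moved inside the
-- combination.
record Span (n : ℕ) (f : ℕ → ℤ) : Set where
  constructor span
  field
    coefficient : ℕ → ℤ
    expansion   : ∀ K → K ℕ.< n → f K ≡ ∑ n (λ L → coefficient L * W K L)

module _ {n : ℕ} where

  span-cong : ∀ {f g} → (∀ K → K ℕ.< n → f K ≡ g K) → Span n f → Span n g
  span-cong f≡g (span c f≡) = span c λ K K<n → trans (sym (f≡g K K<n)) (f≡ K K<n)

  span-+ : ∀ {f g} → Span n f → Span n g → Span n (λ K → f K + g K)
  span-+ {f} {g} (span c f≡) (span d g≡) = span (λ L → c L + d L) λ K K<n → begin
    f K + g K                                           ≡⟨ cong₂ _+_ (f≡ K K<n) (g≡ K K<n) ⟩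
    ∑ n (λ L → c L * W K L) + ∑ n (λ L → d L * W K L)   ≡⟨ ∑-distrib-+ n (λ L → c L * W K L) (λ L → d L * W K L) ⟨
    ∑ n (λ L → c L * W K L + d L * W K L)               ≡⟨ ∑-cong n (λ L _ → ℤ.*-distribʳ-+ (W K L) (c L) (d L)) ⟨
    ∑ n (λ L → (c L + d L) * W K L)                     ∎

  span-scale : ∀ z {f} → Span n f → Span n (λ K → z * f K)
  span-scale z {f} (span c f≡) = span (λ L → z * c L) λ K K<n → begin
    z * f K                          ≡⟨ cong (z *_) (f≡ K K<n) ⟩
    z * ∑ n (λ L → c L * W K L)      ≡⟨ *-distribˡ-∑ n z (λ L → c L * W K L) ⟩
    ∑ n (λ L → z * (c L * W K L))    ≡⟨ ∑-cong n (λ L _ → ℤ.*-assoc z (c L) (W K L)) ⟨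
    ∑ n (λ L → (z * c L) * W K L)    ∎

  span-0 : Span n (λ _ → 0ℤ)
  span-0 = span (λ _ → 0ℤ) λ _ _ → sym (∑-zero n)

  span-∑ : ∀ m {f : ℕ → ℕ → ℤ} → (∀ L → Span n (f L)) → Span n (λ K → ∑ m (λ L → f L K))
  span-∑ zero    s = span-0
  span-∑ (suc m) s = span-+ (span-∑ m s) (s m)

  -- Read off from the product with `W K 0`, which is 1.
  span-W : ∀ L → Span n (λ K → W K L)
  span-W L = span-cong (λ K _ → trans (cong (_* W K L) (W-first K)) (ℤ.*-identityˡ (W K L)))
    (span (D 0 L) λ K → W-product 0 L)

  -- Bilinearity reduces this to `W-product`, whose coefficients `D I J` are independent of K.
  span-* : ∀ {f g} → Span n f → Span n g → Span n (λ K → f K * g K)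
  span-* {f} {g} (span c f≡) (span d g≡) = span-cong expand
    (span-∑ n (λ I → span-scale (c I) (span-∑ n (λ J → span-scale (d J) (span (D I J) λ K → W-product I J)))))
    where
    expand : ∀ K → K ℕ.< n → ∑ n (λ I → c I * ∑ n (λ J → d J * (W K I * W K J))) ≡ f K * g K
    expand K K<n = begin
      ∑ n (λ I → c I * ∑ n (λ J → d J * (W K I * W K J)))
        ≡⟨ ∑-cong n (λ I _ → inner I) ⟩
      ∑ n (λ I → (c I * W K I) * ∑ n (λ J → d J * W K J))
        ≡⟨ *-distribʳ-∑ n (∑ n (λ J → d J * W K J)) (λ I → c I * W K I) ⟨
      ∑ n (λ I → c I * W K I) * ∑ n (λ J → d J * W K J)
        ≡⟨ cong₂ _*_ (f≡ K K<n) (g≡ K K<n) ⟨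
      f K * g K ∎
      where
      algebra : ∀ d v w → d * (v * w) ≡ v * (d * w)
      algebra d v w = solve (d ∷ v ∷ w ∷ [])
      inner : ∀ I → c I * ∑ n (λ J → d J * (W K I * W K J)) ≡ (c I * W K I) * ∑ n (λ J → d J * W K J)
      inner I = begin
        c I * ∑ n (λ J → d J * (W K I * W K J))
          ≡⟨ cong (c I *_) (∑-cong n (λ J _ → algebra (d J) (W K I) (W K J))) ⟩
        c I * ∑ n (λ J → W K I * (d J * W K J))
          ≡⟨ cong (c I *_) (*-distribˡ-∑ n (W K I) (λ J → d J * W K J)) ⟨
        c I * (W K I * ∑ n (λ J → d J * W K J))
          ≡⟨ ℤ.*-assoc (c I) (W K I) (∑ n (λ J → d J * W K J)) ⟨
        (c I * W K I) * ∑ n (λ J → d J * W K J) ∎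

  span-const : ∀ z → Span n (λ _ → z)
  span-const z = span-cong (λ K _ → trans (cong (z *_) (W-first K)) (ℤ.*-identityʳ z)) (span-scale z (span-W 0))

  -- `W-step` at L = 0, where `W K 0` is 1: X = 2 (w(k, 1) + w(k, 2)).
  span-X : Span n X
  span-X = span-cong
    (λ K _ → trans (sym (W-step K 0)) (trans (cong (X K *_) (W-first K)) (ℤ.*-identityʳ (X K))))
    (span-scale (+ 2) (span-+ (span-W 0) (span-W 1)))

  span-^ : ∀ r {f} → Span n f → Span n (λ K → f K ℤ.^ r)
  span-^ zero    s = span-const 1ℤ
  span-^ (suc r) s = span-* s (span-^ r s)

∣-∑ : ∀ {d} n {f : ℕ → ℤ} → (∀ i → d ∣ f i) → d ∣ ∑ n f
∣-∑ zero    d∣f = divides 0ℤ refl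
∣-∑ (suc n) d∣f = ℤ.∣m∣n⇒∣m+n (∣-∑ n d∣f) (d∣f n)

-- Exchanging the two sums reduces divisibility for `h` to divisibility for each `W K L`.
span-∣ : ∀ {d g n} (v : ℕ → ℤ) {h : ℕ → ℤ} → (∀ L → d ∣ g * ∑ n (λ K → v K * W K L)) → Span n h →
         d ∣ g * ∑ n (λ K → v K * h K)
span-∣ {d} {g} {n} v {h} d∣ (span c h≡) = subst (d ∣_) (sym expand) (∣-∑ n (λ L → ℤ.∣n⇒∣m*n (c L) (d∣ L)))
  where
  swap : ∀ a b c → a * (b * c) ≡ b * (a * c)
  swap a b c = solve (a ∷ b ∷ c ∷ [])
  expand : g * ∑ n (λ K → v K * h K) ≡ ∑ n (λ L → c L * (g * ∑ n (λ K → v K * W K L)))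
  expand = begin
    g * ∑ n (λ K → v K * h K)
      ≡⟨ cong (g *_) (∑-cong n (λ K K<n → trans (cong (v K *_) (h≡ K K<n)) (*-distribˡ-∑ n (v K) (λ L → c L * W K L)))) ⟩
    g * ∑ n (λ K → ∑ n (λ L → v K * (c L * W K L)))
      ≡⟨ cong (g *_) (∑-swap n n (λ K L → v K * (c L * W K L))) ⟩
    g * ∑ n (λ L → ∑ n (λ K → v K * (c L * W K L)))
      ≡⟨ cong (g *_) (∑-cong n (λ L _ → trans (∑-cong n (λ K _ → swap (v K) (c L) (W K L))) (sym (*-distribˡ-∑ n (c L) (λ K → v K * W K L))))) ⟩
    g * ∑ n (λ L → c L * ∑ n (λ K → v K * W K L))
      ≡⟨ *-distribˡ-∑ n g (λ L → c L * ∑ n (λ K → v K * W K L)) ⟩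
    ∑ n (λ L → g * (c L * ∑ n (λ K → v K * W K L)))
      ≡⟨ ∑-cong n (λ L _ → swap g (c L) (∑ n (λ K → v K * W K L))) ⟩
    ∑ n (λ L → c L * (g * ∑ n (λ K → v K * W K L))) ∎

-- Integers inside the rationals

-- Arithmetic is moved to unnormalised fractions, where equality is cross multiplication and no gcd
-- intervenes.
fromℚᵘ-+ : ∀ p q → fromℚᵘ p ℚ.+ fromℚᵘ q ≡ fromℚᵘ (p ℚᵘ.+ q)
fromℚᵘ-+ p q = ℚ.toℚᵘ-injective (ℚᵘ.≃-trans (ℚ.toℚᵘ-homo-+ (fromℚᵘ p) (fromℚᵘ q))
  (ℚᵘ.≃-trans (ℚᵘ.+-cong (ℚ.toℚᵘ-fromℚᵘ p) (ℚ.toℚᵘ-fromℚᵘ q)) (ℚᵘ.≃-sym (ℚ.toℚᵘ-fromℚᵘ (p ℚᵘ.+ q)))))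

fromℚᵘ-* : ∀ p q → fromℚᵘ p ℚ.* fromℚᵘ q ≡ fromℚᵘ (p ℚᵘ.* q)
fromℚᵘ-* p q = ℚ.toℚᵘ-injective (ℚᵘ.≃-trans (ℚ.toℚᵘ-homo-* (fromℚᵘ p) (fromℚᵘ q))
  (ℚᵘ.≃-trans (ℚᵘ.*-cong (ℚ.toℚᵘ-fromℚᵘ p) (ℚ.toℚᵘ-fromℚᵘ q)) (ℚᵘ.≃-sym (ℚ.toℚᵘ-fromℚᵘ (p ℚᵘ.* q)))))

fromℤ-+ : ∀ a b → fromℤ a ℚ.+ fromℤ b ≡ fromℤ (a + b)
fromℤ-+ a b = trans (fromℚᵘ-+ (mkℚᵘ a 0) (mkℚᵘ b 0)) (ℚ.fromℚᵘ-cong {mkℚᵘ a 0 ℚᵘ.+ mkℚᵘ b 0} {mkℚᵘ (a + b) 0} (*≡* (algebra a b)))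
  where
  algebra : ∀ a b → (a * 1ℤ + b * 1ℤ) * 1ℤ ≡ (a + b) * 1ℤ
  algebra a b = solve (a ∷ b ∷ [])

fromℤ-* : ∀ a b → fromℤ a ℚ.* fromℤ b ≡ fromℤ (a * b)
fromℤ-* a b = fromℚᵘ-* (mkℚᵘ a 0) (mkℚᵘ b 0)

/-integral : ∀ {a z} d .{{_ : NonZero d}} → a ≡ z * + d → a / d ≡ fromℤ z
/-integral {a} {z} (suc d) a≡z*d = ℚ.fromℚᵘ-cong {mkℚᵘ a d} {mkℚᵘ z 0}
  (*≡* (trans (ℤ.*-identityʳ a) a≡z*d))

/-*-integral : ∀ {a b z} d .{{_ : NonZero d}} → a * b ≡ z * + d → (a / d) ℚ.* fromℤ b ≡ fromℤ z
/-*-integral {a} {b} {z} (suc d) eq = trans (fromℚᵘ-* (mkℚᵘ a d) (mkℚᵘ b 0))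
  (ℚ.fromℚᵘ-cong {mkℚᵘ a d ℚᵘ.* mkℚᵘ b 0} {mkℚᵘ z 0}
    (*≡* (trans (ℤ.*-identityʳ (a * b)) (trans eq (cong (λ e → z * + e) (sym (ℕ.*-identityʳ (suc d))))))))

w≡W : ∀ K L → w (suc K) (suc L) ≡ fromℤ (W K L)
w≡W K L = /-integral {z = W K L} (suc L) (begin
  + ((K ℕ.C L) ℕ.* ((suc K ℕ.+ suc L) ℕ.C L))       ≡⟨ ℤ.pos-* (K ℕ.C L) _ ⟩
  + (K ℕ.C L) * + ((suc K ℕ.+ suc L) ℕ.C L)         ≡⟨ cong₂ _*_ (choose-def K L) (choose-def (suc K ℕ.+ suc L) L) ⟨
  K choose L * (suc K ℕ.+ suc L) choose L           ≡⟨ [1+L]*W K L ⟨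
  + suc L * W K L                                   ≡⟨ ℤ.*-comm (+ suc L) (W K L) ⟩
  W K L * + suc L                                   ∎)

-- Coefficients of polynomials

tailₚ : Poly → Poly
tailₚ []      = []
tailₚ (_ ∷ p) = p

coeff-tailₚ : ∀ p i → coeff (tailₚ p) i ≡ coeff p (suc i)
coeff-tailₚ []      i = refl
coeff-tailₚ (a ∷ p) i = refl

coeff-+ₚ : ∀ p q i → coeff (p +ₚ q) i ≡ coeff p i ℚ.+ coeff q i
coeff-+ₚ []      q       i       = sym (ℚ.+-identityˡ (coeff q i))
coeff-+ₚ (a ∷ p) []      i       = sym (ℚ.+-identityʳ (coeff (a ∷ p) i))
coeff-+ₚ (a ∷ p) (b ∷ q) zero    = refl
coeff-+ₚ (a ∷ p) (b ∷ q) (suc i) = coeff-+ₚ p q i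

coeff-·ₚ : ∀ a p i → coeff (a ·ₚ p) i ≡ a ℚ.* coeff p i
coeff-·ₚ a []      i       = sym (ℚ.*-zeroʳ a)
coeff-·ₚ a (b ∷ p) zero    = refl
coeff-·ₚ a (b ∷ p) (suc i) = coeff-·ₚ a p i

coeff-*ₚ-zero : ∀ p q → coeff (p *ₚ q) 0 ≡ coeff p 0 ℚ.* coeff q 0
coeff-*ₚ-zero []      q = sym (ℚ.*-zeroˡ (coeff q 0))
coeff-*ₚ-zero (a ∷ p) q = begin
  coeff ((a ·ₚ q) +ₚ (0ℚ ∷ (p *ₚ q))) 0   ≡⟨ coeff-+ₚ (a ·ₚ q) _ 0 ⟩
  coeff (a ·ₚ q) 0 ℚ.+ 0ℚ                 ≡⟨ ℚ.+-identityʳ _ ⟩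
  coeff (a ·ₚ q) 0                        ≡⟨ coeff-·ₚ a q 0 ⟩
  a ℚ.* coeff q 0                         ∎

-- A recursion on the index rather than on the list, since the length of `wPoly α k` varies with k.
coeff-*ₚ-suc : ∀ p q i → coeff (p *ₚ q) (suc i) ≡ coeff p 0 ℚ.* coeff q (suc i) ℚ.+ coeff (tailₚ p *ₚ q) i
coeff-*ₚ-suc []      q i = sym (trans (ℚ.+-identityʳ _) (ℚ.*-zeroˡ (coeff q (suc i))))
coeff-*ₚ-suc (a ∷ p) q i = trans (coeff-+ₚ (a ·ₚ q) _ (suc i))
  (cong (ℚ._+ coeff (p *ₚ q) i) (coeff-·ₚ a q (suc i)))

-- One formula for every index: beyond the degree `W K i` is zero, and so is its power because α is
-- positive.
coeff-wPoly : ∀ α K i .{{_ : NonZero α}} → coeff (wPoly α (suc K)) i ≡ fromℤ (W K i) ^ℚ α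
coeff-wPoly α K i = below (suc K) _ i (λ i → cong (_^ℚ α) (w≡W K i)) λ K<i → power-zero α (cong fromℤ (W-zero K<i))
  where
  power-zero : ∀ α .{{_ : NonZero α}} {x} → x ≡ 0ℚ → x ^ℚ α ≡ 0ℚ
  power-zero (suc α) {x} x≡0 = trans (cong (ℚ._* x ^ℚ α) x≡0) (ℚ.*-zeroˡ (x ^ℚ α))
  below : ∀ m (f : ℕ → ℚ) {g : ℕ → ℚ} i → (∀ i → f i ≡ g i) → (m ℕ.≤ i → g i ≡ 0ℚ) → coeff (applyUpTo f m) i ≡ g i
  below zero    f i       f≡g g≡0 = sym (g≡0 ℕ.z≤n)
  below (suc m) f zero    f≡g g≡0 = f≡g 0
  below (suc m) f {g} (suc i) f≡g g≡0 = below m (λ i → f (suc i)) {λ i → g (suc i)} i (λ i → f≡g (suc i)) (λ m≤i → g≡0 (ℕ.s≤s m≤i))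

-- Polynomials whose coefficients lie in the span

record Spanℚ (n : ℕ) (f : ℕ → ℚ) : Set where
  constructor spanℚ
  field
    {integer} : ℕ → ℤ
    inSpan    : Span n integer
    agreement : ∀ K → f K ≡ fromℤ (integer K)

module _ {n : ℕ} where

  spanℚ-cong : ∀ {f g} → (∀ K → f K ≡ g K) → Spanℚ n g → Spanℚ n f
  spanℚ-cong f≡g (spanℚ s g≡a) = spanℚ s λ K → trans (f≡g K) (g≡a K)

  spanℚ-const : ∀ z → Spanℚ n (λ _ → fromℤ z)
  spanℚ-const z = spanℚ (span-const z) λ _ → refl

  spanℚ-+ : ∀ {f g} → Spanℚ n f → Spanℚ n g → Spanℚ n (λ K → f K ℚ.+ g K)
  spanℚ-+ (spanℚ {a} s f≡a) (spanℚ {b} t g≡b) = spanℚ (span-+ s t) λ K → trans (cong₂ ℚ._+_ (f≡a K) (g≡b K)) (fromℤ-+ (a K) (b K))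

  spanℚ-* : ∀ {f g} → Spanℚ n f → Spanℚ n g → Spanℚ n (λ K → f K ℚ.* g K)
  spanℚ-* (spanℚ {a} s f≡a) (spanℚ {b} t g≡b) = spanℚ (span-* s t) λ K → trans (cong₂ ℚ._*_ (f≡a K) (g≡b K)) (fromℤ-* (a K) (b K))

  spanℚ-^ : ∀ α {f} → Spanℚ n f → Spanℚ n (λ K → f K ^ℚ α)
  spanℚ-^ zero    s = spanℚ-const 1ℤ
  spanℚ-^ (suc α) s = spanℚ-* s (spanℚ-^ α s)

record Spanₚ (n : ℕ) (P : ℕ → Poly) : Set where
  constructor spanₚ
  field
    coeffwise : ∀ i → Spanℚ n (λ K → coeff (P K) i)
open Spanₚ

module _ {n : ℕ} where

  spanₚ-tailₚ : ∀ {P} → Spanₚ n P → Spanₚ n (λ K → tailₚ (P K))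
  spanₚ-tailₚ {P} s = spanₚ λ i → spanℚ-cong (λ K → coeff-tailₚ (P K) i) (coeffwise s (suc i))

  spanₚ-*ₚ : ∀ {P Q} → Spanₚ n P → Spanₚ n Q → Spanₚ n (λ K → P K *ₚ Q K)
  spanₚ-*ₚ {Q = Q} s t = spanₚ (product s)
    where
    -- `P` is generalised because the induction on the index replaces it by its tail.
    product : ∀ {P} → Spanₚ n P → ∀ i → Spanℚ n (λ K → coeff (P K *ₚ Q K) i)
    product {P} s zero    = spanℚ-cong (λ K → coeff-*ₚ-zero (P K) (Q K)) (spanℚ-* (coeffwise s 0) (coeffwise t 0))
    product {P} s (suc i) = spanℚ-cong (λ K → coeff-*ₚ-suc (P K) (Q K) i)
      (spanℚ-+ (spanℚ-* (coeffwise s 0) (coeffwise t (suc i))) (product (spanₚ-tailₚ s) i))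

  spanₚ-^ₚ : ∀ m {P} → Spanₚ n P → Spanₚ n (λ K → P K ^ₚ m)
  spanₚ-^ₚ zero    s = spanₚ λ where
    zero    → spanℚ-const 1ℤ
    (suc i) → spanℚ-const 0ℤ
  spanₚ-^ₚ (suc m) s = spanₚ-*ₚ s (spanₚ-^ₚ m s)

  spanₚ-wPoly : ∀ α .{{_ : NonZero α}} → Spanₚ n (λ K → wPoly α (suc K))
  spanₚ-wPoly α = spanₚ λ i → spanℚ-cong (λ K → coeff-wPoly α K i)
    (spanℚ-^ α (spanℚ (span-W i) λ _ → refl))

-- The weighted sum, its weight and its prefactor

-- Shifts the index: `Σₚ` starts at k = 1 and `∑` at K = 0.
coeff-Σₚ : ∀ n (P : ℕ → Poly) i (s g : ℕ → ℤ) → (∀ K → coeff (P (suc K)) i ≡ fromℤ (g K)) →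
           coeff (Σₚ n (λ k → fromℤ (s k) ·ₚ P k)) i ≡ fromℤ (∑ n (λ K → s (suc K) * g K))
coeff-Σₚ zero    P i s g P≡g = refl
coeff-Σₚ (suc n) P i s g P≡g = begin
  coeff (Σₚ n (λ k → fromℤ (s k) ·ₚ P k) +ₚ fromℤ (s (suc n)) ·ₚ P (suc n)) i
    ≡⟨ coeff-+ₚ (Σₚ n (λ k → fromℤ (s k) ·ₚ P k)) _ i ⟩
  coeff (Σₚ n (λ k → fromℤ (s k) ·ₚ P k)) i ℚ.+ coeff (fromℤ (s (suc n)) ·ₚ P (suc n)) i
    ≡⟨ cong₂ ℚ._+_ (coeff-Σₚ n P i s g P≡g) (coeff-·ₚ (fromℤ (s (suc n))) (P (suc n)) i) ⟩
  fromℤ (∑ n (λ K → s (suc K) * g K)) ℚ.+ fromℤ (s (suc n)) ℚ.* coeff (P (suc n)) i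
    ≡⟨ cong (fromℤ (∑ n (λ K → s (suc K) * g K)) ℚ.+_)
         (trans (cong (fromℤ (s (suc n)) ℚ.*_) (P≡g n)) (fromℤ-* (s (suc n)) (g n))) ⟩
  fromℤ (∑ n (λ K → s (suc K) * g K)) ℚ.+ fromℤ (s (suc n) * g n)
    ≡⟨ fromℤ-+ (∑ n (λ K → s (suc K) * g K)) (s (suc n) * g n) ⟩
  fromℤ (∑ n (λ K → s (suc K) * g K) + s (suc n) * g n) ∎

∈ℤ[x]-coeffwise : ∀ p → (∀ i → ∃[ z ] coeff p i ≡ fromℤ z) → p ∈ℤ[x]
∈ℤ[x]-coeffwise []      int = [] , λ _ → refl
∈ℤ[x]-coeffwise (a ∷ p) int with int 0 | ∈ℤ[x]-coeffwise p (λ i → int (suc i))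
... | z , a≡z | q , p≈q = z ∷ q , λ where
  zero    → a≡z
  (suc i) → p≈q i

pos-^-* : ∀ a b r → + (a ℕ.^ r ℕ.* b ℕ.^ r) ≡ (+ a * + b) ℤ.^ r
pos-^-* a b zero    = refl
pos-^-* a b (suc r) = begin
  + ((a ℕ.* a ℕ.^ r) ℕ.* (b ℕ.* b ℕ.^ r))   ≡⟨ cong +_ (ℕ.[m*n]*[o*p]≡[m*o]*[n*p] a (a ℕ.^ r) b (b ℕ.^ r)) ⟩
  + ((a ℕ.* b) ℕ.* (a ℕ.^ r ℕ.* b ℕ.^ r))   ≡⟨ ℤ.pos-* (a ℕ.* b) _ ⟩
  + (a ℕ.* b) * + (a ℕ.^ r ℕ.* b ℕ.^ r)     ≡⟨ cong₂ _*_ (ℤ.pos-* a b) (pos-^-* a b r) ⟩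
  (+ a * + b) * (+ a * + b) ℤ.^ r           ∎

-- Positivity of the exponent supplies the one factor X that stays with 2k + 1, as in `X-summand`.
weight-suc : ∀ r K → weight (suc r) (suc K) ≡ (X K * + (3 ℕ.+ (K ℕ.+ K))) * X K ℤ.^ r
weight-suc r K = begin
  + (suc K ℕ.^ suc r ℕ.* (suc K ℕ.+ 1) ℕ.^ suc r ℕ.* (2 ℕ.* suc K ℕ.+ 1))
    ≡⟨ ℤ.pos-* (suc K ℕ.^ suc r ℕ.* (suc K ℕ.+ 1) ℕ.^ suc r) _ ⟩
  + (suc K ℕ.^ suc r ℕ.* (suc K ℕ.+ 1) ℕ.^ suc r) * + (2 ℕ.* suc K ℕ.+ 1)
    ≡⟨ cong₂ _*_ (trans (cong (λ k → + (suc K ℕ.^ suc r ℕ.* k ℕ.^ suc r)) (ℕ.+-comm (suc K) 1)) (pos-^-* (suc K) (2 ℕ.+ K) (suc r)))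
         (trans (cong (_+ 1ℤ) (ℤ.pos-* 2 (suc K))) (algebra₁ (+ K))) ⟩
  (X K * X K ℤ.^ r) * + (3 ℕ.+ (K ℕ.+ K))
    ≡⟨ algebra₂ (X K) (X K ℤ.^ r) (+ (3 ℕ.+ (K ℕ.+ K))) ⟩
  (X K * + (3 ℕ.+ (K ℕ.+ K))) * X K ℤ.^ r ∎
  where
  algebra₁ : ∀ k → + 2 * (1ℤ + k) + 1ℤ ≡ + 3 + (k + k)
  algebra₁ k = solve (k ∷ [])
  algebra₂ : ∀ a b c → (a * b) * c ≡ (a * c) * b
  algebra₂ a b c = solve (a ∷ b ∷ c ∷ [])

prefactor-integral : ∀ N {y z : ℤ} → + gcd 2 (suc N) * y ≡ z * (X N * + (3 ℕ.+ N)) →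
                     prefactor (suc N) ℚ.* fromℤ y ≡ fromℤ z
prefactor-integral N {y} {z} eq = /-*-integral {+ gcd 2 (suc N)} {y} {z} (suc N ℕ.* suc (suc N) ℕ.* (3 ℕ.+ N))
  (trans eq (cong (z *_) (sym denominator)))
  where
  denominator : + (suc N ℕ.* suc (suc N) ℕ.* (3 ℕ.+ N)) ≡ X N * + (3 ℕ.+ N)
  denominator = trans (ℤ.pos-* (suc N ℕ.* suc (suc N)) (3 ℕ.+ N)) (cong (_* + (3 ℕ.+ N)) (ℤ.pos-* (suc N) (suc (suc N))))

-- Treats both sums at once, with `σ K` the sign of the term k = K + 1.
integral-sum : ∀ α m N r .{{_ : NonZero α}} (σ s : ℕ → ℤ) →
  (∀ K → s (suc K) ≡ σ K * ((X K * + (3 ℕ.+ (K ℕ.+ K))) * X K ℤ.^ r)) →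
  (∀ L → X N ∣ ∑ (suc N) (λ K → σ K * X-summand L K)) →
  (∀ L → + (3 ℕ.+ N) ∣ ∑ (suc N) (λ K → σ K * X-summand L K)) →
  prefactor (suc N) ·ₚ Σₚ (suc N) (λ k → fromℤ (s k) ·ₚ wPoly α k ^ₚ m) ∈ℤ[x]
integral-sum α m N r σ s s≡ x∣ y∣ = ∈ℤ[x]-coeffwise (prefactor n ·ₚ summed) integral
  where
  n = suc N
  summed = Σₚ n (λ k → fromℤ (s k) ·ₚ wPoly α k ^ₚ m)
  v : ℕ → ℤ
  v K = σ K * (X K * + (3 ℕ.+ (K ℕ.+ K)))
  v-divisible : ∀ L → X N * + (3 ℕ.+ N) ∣ + gcd 2 n * ∑ n (λ K → v K * W K L)
  v-divisible L = subst (λ S → X N * + (3 ℕ.+ N) ∣ + gcd 2 n * S)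
    (∑-cong n (λ K _ → sym (ℤ.*-assoc (σ K) _ (W K L))))
    (gcd-divisible N (x∣ L) (y∣ L))
  regroup : ∀ a b c d → (a * (b * c)) * d ≡ (a * b) * (c * d)
  regroup a b c d = solve (a ∷ b ∷ c ∷ d ∷ [])
  integral : ∀ i → ∃[ z ] coeff (prefactor n ·ₚ summed) i ≡ fromℤ z
  integral i = from-span (coeffwise (spanₚ-^ₚ m (spanₚ-wPoly α)) i)
    where
    from-quotient : ∀ {g} → (∀ K → coeff (wPoly α (suc K) ^ₚ m) i ≡ fromℤ (g K)) →
      X N * + (3 ℕ.+ N) ∣ + gcd 2 n * ∑ n (λ K → v K * (X K ℤ.^ r * g K)) →
      ∃[ z ] coeff (prefactor n ·ₚ summed) i ≡ fromℤ z
    from-quotient {g} P≡g (divides z eq) = z , (begin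
      coeff (prefactor n ·ₚ summed) i
        ≡⟨ coeff-·ₚ (prefactor n) summed i ⟩
      prefactor n ℚ.* coeff summed i
        ≡⟨ cong (prefactor n ℚ.*_) (coeff-Σₚ n (λ k → wPoly α k ^ₚ m) i s g P≡g) ⟩
      prefactor n ℚ.* fromℤ (∑ n (λ K → s (suc K) * g K))
        ≡⟨ cong (λ y → prefactor n ℚ.* fromℤ y) (∑-cong n (λ K _ →
             trans (cong (_* g K) (s≡ K)) (regroup (σ K) _ (X K ℤ.^ r) (g K)))) ⟩
      prefactor n ℚ.* fromℤ (∑ n (λ K → v K * (X K ℤ.^ r * g K)))
        ≡⟨ prefactor-integral N {z = z} eq ⟩
      fromℤ z ∎)
    from-span : Spanℚ n (λ K → coeff (wPoly α (suc K) ^ₚ m) i) →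
      ∃[ z ] coeff (prefactor n ·ₚ summed) i ≡ fromℤ z
    from-span (spanℚ {g} g-span P≡g) = from-quotient {g} P≡g
      -- The remaining power of X is absorbed into the coefficient, and the product is again in the
      -- span.
      (span-∣ {g = + gcd 2 n} v v-divisible (span-* (span-^ r span-X) g-span))

theorem3 : ∀ (α m n r : ℕ) .{{_ : NonZero α}} .{{_ : NonZero m}} .{{_ : NonZero n}} .{{_ : NonZero r}} →
    (prefactor n ·ₚ Σₚ n (λ k → fromℤ (weight r k) ·ₚ wPoly α k ^ₚ m) ∈ℤ[x])
    × (prefactor n ·ₚ Σₚ n (λ k → fromℤ (-1ℤ ℤ.^ k ℤ.* weight r k) ·ₚ wPoly α k ^ₚ m) ∈ℤ[x])
theorem3 α m (suc N) (suc r) =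
  integral-sum α m N r (λ _ → 1ℤ) (weight (suc r))
    (λ K → trans (weight-suc r K) (sym (ℤ.*-identityˡ _)))
    (λ L → subst (X N ∣_) (unsigned L) (X∣∑ N L))
    (λ L → subst (+ (3 ℕ.+ N) ∣_) (unsigned L) ([3+N]∣∑ N L))
  -- `σ` is indexed by K = k - 1, so the sign (-1)^k becomes (-1)^(K + 1).
  , integral-sum α m N r (λ K → -1ℤ ℤ.^ suc K) (λ k → -1ℤ ℤ.^ k * weight (suc r) k)
    (λ K → cong (-1ℤ ℤ.^ suc K *_) (weight-suc r K))
    (X∣∑-alternating N) ([3+N]∣∑-alternating N)
  where
  unsigned : ∀ L → ∑ (suc N) (X-summand L) ≡ ∑ (suc N) (λ K → 1ℤ * X-summand L K)
  unsigned L = ∑-cong (suc N) (λ K _ → sym (ℤ.*-identityˡ (X-summand L K)))
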